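{- Every strongly maximal element of a continuous dcpo is sharp.
   Context: Everything is constructive: neither excluded middle nor choice is assumed. A subset $S$ of a poset is directed if it is inhabited and any two elements of $S$ have an upper bound in $S$. A dcpo is a poset $(D,\sqsubseteq)$ in which every directed subset $S$ has a supremum $\bigsqcup S$. Write $x\ll y$ ($x$ is way below $y$) if for every directed $S$ with $y\sqsubseteq\bigsqcup S$ there is $s\in S$ with $x\sqsubseteq s$. $D$ is continuous if for every $x$ the set $\{y\in D\mid y\ll x\}$ is directed with supremum $x$. A subset $U\subseteq D$ is Scott open if it is an upper set and whenever $\bigsqcup S\in U$ with $S$ directed, some $s\in S$ is in $U$. Two points of $D$ are Hausdorff separated if they have disjoint Scott open neighbourhoods. An element $x$ of a continuous dcpo $D$ is strongly maximal if for every $u,v\in D$ with $u\ll v$, we have $u\ll x$, or $v$ and $x$ are Hausdorff separated. An element $x\in D$ is sharp if for every $y,z\in D$ with $y\ll z$ we have $y\ll x$ or $\lnot(z\sqsubseteq x)$. -}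

module Defs where

open import Level using (Level; _⊔_; suc)
open import Data.Product.Base using (Σ-syntax; ∃-syntax; _×_; _,_)
open import Data.Sum.Base using (_⊎_)
open import Relation.Binary.Bundles using (Poset)
open import Relation.Binary.Definitions using (_Respects_)
open import Relation.Nullary.Negation.Core using (¬_)
open import Relation.Unary using (Pred; _⊥_)

private
  variable
    c ℓ₁ ℓ₂ p : Level

module _ (P : Poset c ℓ₁ ℓ₂) where
  open Poset P renaming (_≤_ to _⊑_)

  -- Equality in a Poset is the setoid equality _≈_, so a subset is a
  -- predicate that is invariant under it.
  record Subset (p : Level) : Set (c ⊔ ℓ₁ ⊔ suc p) where
    field
      pred     : Pred Carrier p
      respects : pred Respects _≈_

module _ {P : Poset c ℓ₁ ℓ₂} where
  open Poset P renaming (_≤_ to _⊑_)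

  infix 4 _∈_

  _∈_ : Carrier → Subset P p → Set p
  x ∈ S = Subset.pred S x

  IsUpperBound : Subset P p → Carrier → Set (c ⊔ ℓ₂ ⊔ p)
  IsUpperBound S u = ∀ x → x ∈ S → x ⊑ u

  IsSupremum : Subset P p → Carrier → Set (c ⊔ ℓ₂ ⊔ p)
  IsSupremum S u = IsUpperBound S u × (∀ v → IsUpperBound S v → u ⊑ v)

  IsDirected : Subset P p → Set (c ⊔ ℓ₂ ⊔ p)
  IsDirected S =
    (∃[ x ] x ∈ S) ×
    (∀ x y → x ∈ S → y ∈ S → ∃[ z ] (z ∈ S × x ⊑ z × y ⊑ z))

-- There is no type of all subsets, only one for each universe level; s is the
-- level of the directed subsets that have suprema and against which
-- way-below and Scott openness are tested.
record DCPO (c ℓ₁ ℓ₂ s : Level) : Set (suc (c ⊔ ℓ₁ ⊔ ℓ₂ ⊔ s)) where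
  field
    poset : Poset c ℓ₁ ℓ₂

  open Poset poset public renaming (_≤_ to _⊑_)

  field
    ⨆            : (S : Subset poset s) → IsDirected S → Carrier
    ⨆-isSupremum : (S : Subset poset s) (δ : IsDirected S) →
                   IsSupremum S (⨆ S δ)

module _ {s : Level} (D : DCPO c ℓ₁ ℓ₂ s) where
  open DCPO D

  WayBelow : Carrier → Carrier → Set (c ⊔ ℓ₁ ⊔ ℓ₂ ⊔ suc s)
  WayBelow x y = (S : Subset poset s) (δ : IsDirected S) →
                 y ⊑ ⨆ S δ → ∃[ d ] (d ∈ S × x ⊑ d)

  private
    infix 4 _≪_

    _≪_ : Carrier → Carrier → Set (c ⊔ ℓ₁ ⊔ ℓ₂ ⊔ suc s)
    _≪_ = WayBelow

  wayBelowSubset : Carrier → Subset poset (c ⊔ ℓ₁ ⊔ ℓ₂ ⊔ suc s)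
  wayBelowSubset x = record
    { pred     = λ y → y ≪ x
    ; respects = λ y≈y′ y≪x S δ x⊑⨆S →
        let d , d∈S , y⊑d = y≪x S δ x⊑⨆S
        in d , d∈S , trans (reflexive (Eq.sym y≈y′)) y⊑d
    }

  IsContinuous : Set (c ⊔ ℓ₁ ⊔ ℓ₂ ⊔ suc s)
  IsContinuous =
    ∀ x → IsDirected (wayBelowSubset x) × IsSupremum (wayBelowSubset x) x

  IsUpperSet : Subset poset p → Set (c ⊔ ℓ₂ ⊔ p)
  IsUpperSet U = ∀ x y → x ∈ U → x ⊑ y → y ∈ U

  IsScottOpen : Subset poset p → Set (c ⊔ ℓ₁ ⊔ ℓ₂ ⊔ suc s ⊔ p)
  IsScottOpen U =
    IsUpperSet U ×
    ((S : Subset poset s) (δ : IsDirected S) →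
     ⨆ S δ ∈ U → ∃[ d ] (d ∈ S × d ∈ U))

  -- The level t of the separating open sets is independent of s: already the
  -- basic open sets { y | x ≪ y } live above s.
  HausdorffSeparated : (t : Level) → Carrier → Carrier →
                       Set (c ⊔ ℓ₁ ⊔ ℓ₂ ⊔ suc s ⊔ suc t)
  HausdorffSeparated t x y =
    Σ[ U ∈ Subset poset t ] Σ[ V ∈ Subset poset t ]
      (IsScottOpen U × IsScottOpen V × x ∈ U × y ∈ V ×
       Subset.pred U ⊥ Subset.pred V)

  IsStronglyMaximal : (t : Level) → Carrier →
                      Set (c ⊔ ℓ₁ ⊔ ℓ₂ ⊔ suc s ⊔ suc t)
  IsStronglyMaximal t x =
    ∀ u v → u ≪ v → u ≪ x ⊎ HausdorffSeparated t v x

  IsSharp : Carrier → Set (c ⊔ ℓ₁ ⊔ ℓ₂ ⊔ suc s)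
  IsSharp x = ∀ y z → y ≪ z → y ≪ x ⊎ ¬ (z ⊑ x)

{-# OPTIONS --safe #-}
module Submission where

open import Defs
open import Data.Product.Base using (_,_)
open import Data.Sum.Base using (map₂)
open import Level using (Level)
open import Relation.Nullary.Negation.Core using (¬_)

private
  variable
    c ℓ₁ ℓ₂ s t : Level

module _ (D : DCPO c ℓ₁ ℓ₂ s) where
  open DCPO D

  -- Scott open sets are upper, so `x ⊑ y` would carry `y` into the neighbourhood `U` of `x`, where
  -- it meets the disjoint `V`.
  separated⇒⋢ : ∀ {x y} → HausdorffSeparated D t x y → ¬ (x ⊑ y)
  separated⇒⋢ {x = x} {y} (_ , _ , (U-upper , _) , _ , x∈U , y∈V , U⊥V) x⊑y =
    U⊥V (U-upper x y x∈U x⊑y , y∈V)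

proposition6p3 : ∀ {c ℓ₁ ℓ₂ s t : Level} (D : DCPO c ℓ₁ ℓ₂ s) → IsContinuous D →
    ∀ (x : DCPO.Carrier D) → IsStronglyMaximal D t x → IsSharp D x
proposition6p3 D _ x x-strongly-maximal y z y≪z =
  -- Both notions offer a choice for each pair `y ≪ z` and share the alternative `y ≪ x`; only the
  -- other one has to be weakened, from separation of `z` and `x` to `¬ (z ⊑ x)`.
  map₂ (separated⇒⋢ D) (x-strongly-maximal y z y≪z)
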